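{- For every formula $\varphi\in\mathcal L^*$, $\varphi$ is valid on all $\mathsf{WK}$-models if and only if $\tau(\varphi)$ is valid on all $\mathsf{PDL}$-models.
   Context: Language. Let $\mathrm{Prop}$ be a set of proposition symbols. $\mathcal L^*$ is given by $\varphi ::= \bot \mid p\mid \varphi\land\varphi \mid \varphi\lor\varphi \mid \varphi\to\varphi \mid \Box\varphi \mid \Diamond\varphi \mid \Box^*\varphi \mid \Diamond^*\varphi$, with $p\in\mathrm{Prop}$. Relations. $(R;S)$ is composition: $x(R;S)y$ iff there is $z$ with $xRz$ and $zSy$. $R^*$ is the reflexive-transitive closure of $R$. $\mathsf{WK}$-models. A $\mathsf{WK}$-model is $\mathcal M=(W,\preccurlyeq,R,\|\cdot\|)$ where $\preccurlyeq$ is a preorder on $W$, $R$ is any binary relation on $W$, and $\|\cdot\|:\mathrm{Prop}\cup\{\bot\}\to\mathcal P(W)$ satisfies $\|\bot\|=\varnothing$ and, for all $p\in\mathrm{Prop}$, if $w\preccurlyeq v$ and $w\in\|p\|$ then $v\in\|p\|$. Satisfaction. $(\mathcal M,w)\Vdash\bot$ iff $w\in\|\bot\|$; $(\mathcal M,w)\Vdash p$ iff $w\in\|p\|$; $\wedge,\vee$ are interpreted pointwise as usual; $(\mathcal M,w)\Vdash\varphi\to\psi$ iff for all $v\succcurlyeq w$, $(\mathcal M,v)\Vdash\varphi$ implies $(\mathcal M,v)\Vdash\psi$; $(\mathcal M,w)\Vdash\Box\varphi$ iff $(\mathcal M,v)\Vdash\varphi$ for all $v$ with $w(\preccurlyeq;R)v$;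 $(\mathcal M,w)\Vdash\Diamond\varphi$ iff for all $v\succcurlyeq w$ there is $u$ with $vRu$ and $(\mathcal M,u)\Vdash\varphi$; $(\mathcal M,w)\Vdash\Box^*\varphi$ iff $(\mathcal M,v)\Vdash\varphi$ for all $v$ with $w(\preccurlyeq;R)^*v$; $(\mathcal M,w)\Vdash\Diamond^*\varphi$ iff for all $v\succcurlyeq w$ there is $u$ with $vR^*u$ and $(\mathcal M,u)\Vdash\varphi$. A formula is valid on a model if it is satisfied at all its worlds. $\mathsf{PDL}$. Formulas $\varphi ::= p\mid\neg\varphi\mid\varphi\wedge\varphi\mid\varphi\vee\varphi\mid[\alpha]\varphi$ and programs $\alpha::=a\mid(\alpha;\alpha)\mid\alpha^*$, with $p\in\mathrm{Prop}$ and $a\in\Pi_0=\{i,m\}$; $\langle\alpha\rangle$ abbreviates $\neg[\alpha]\neg$. A $\mathsf{PDL}$-model is $\mathfrak M=(W,\rho,\|\cdot\|)$ with $\|\cdot\|:\mathrm{Prop}\to\mathcal P(W)$ and $\rho$ assigning to each atomic program a binary relation on $W$ (no conditions), extended by $\rho(\alpha;\beta)=\rho(\alpha);\rho(\beta)$ and $\rho(\alpha^*)=\rho(\alpha)^*$. Boolean connectives are classical, and $(\mathfrak M,w)\Vdash[\alpha]\varphi$ iff $(\mathfrak M,v)\Vdash\varphi$ for all $v$ with $w\,\rho(\alpha)\,v$. Validity means truth at all worlds. Translation. Fix a variable $p_\bot\in\mathrm{Prop}$. The map $\tau$ from $\mathcal L^*$ to $\mathsf{PDL}$-formulas is: $\tau(\bot)=p_\bot\wedge\neg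 p_\bot$; $\tau(p)=[i^*]p$; $\tau(\varphi\odot\psi)=\tau(\varphi)\odot\tau(\psi)$ for $\odot\in\{\wedge,\vee\}$; $\tau(\varphi\to\psi)=[i^*](\neg\tau(\varphi)\vee\tau(\psi))$; $\tau(\Box\varphi)=[i^*;m]\tau(\varphi)$; $\tau(\Box^*\varphi)=[(i^*;m)^*]\tau(\varphi)$; $\tau(\Diamond\varphi)=[i^*]\langle m\rangle\tau(\varphi)$; $\tau(\Diamond^*\varphi)=[i^*]\langle m^*\rangle\tau(\varphi)$. -}

module Defs where

open import Data.Product using (_×_; ∃)
open import Data.Sum using (_⊎_)
open import Level using (Level; _⊔_) renaming (suc to lsuc)
open import Relation.Binary.Construct.Closure.ReflexiveTransitive using (Star)
open import Relation.Binary.Construct.Composition using (_;_)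
open import Relation.Binary.Core using (Rel)
open import Relation.Binary.PropositionalEquality using (_≡_)
open import Relation.Binary.Structures using (IsPreorder)
open import Relation.Nullary using (¬_)
open import Relation.Unary using (Pred; Empty; _∈_)

private
  variable
    a ℓ : Level

infixr 8 □_ ◇_ □*_ ◇*_
infixr 7 _∧_
infixr 6 _∨_
infixr 5 _⇒_

data Formula (Var : Set a) : Set a where
  bot             : Formula Var
  var             : Var → Formula Var
  _∧_ _∨_ _⇒_     : Formula Var → Formula Var → Formula Var
  □_ ◇_ □*_ ◇*_   : Formula Var → Formula Var

-- The valuation ‖·‖ : Var ∪ {⊥} → 𝒫(W) is split into its restriction V to
-- Var and its value V⊥ at ⊥.
record WKModel (Var : Set a) (ℓ : Level) : Set (a ⊔ lsuc ℓ) where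
  infix 4 _≼_
  field
    W          : Set ℓ
    _≼_        : Rel W ℓ
    ≼-preorder : IsPreorder _≡_ _≼_
    R          : Rel W ℓ
    V          : Var → Pred W ℓ
    V⊥         : Pred W ℓ
    V⊥-empty   : Empty V⊥
    V-mono     : ∀ p {w v} → w ≼ v → w ∈ V p → v ∈ V p

module _ {Var : Set a} (M : WKModel Var ℓ) where
  open WKModel M

  infix 4 _⊩_

  _⊩_ : W → Formula Var → Set ℓ
  w ⊩ bot     = w ∈ V⊥
  w ⊩ var p   = w ∈ V p
  w ⊩ (φ ∧ ψ) = w ⊩ φ × w ⊩ ψ
  w ⊩ (φ ∨ ψ) = w ⊩ φ ⊎ w ⊩ ψ
  w ⊩ (φ ⇒ ψ) = ∀ v → w ≼ v → v ⊩ φ → v ⊩ ψ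
  w ⊩ (□ φ)   = ∀ v → (_≼_ ; R) w v → v ⊩ φ
  w ⊩ (◇ φ)   = ∀ v → w ≼ v → ∃ λ u → R v u × u ⊩ φ
  w ⊩ (□* φ)  = ∀ v → Star (_≼_ ; R) w v → v ⊩ φ
  w ⊩ (◇* φ)  = ∀ v → w ≼ v → ∃ λ u → Star R v u × u ⊩ φ

  WKValidOn : Formula Var → Set ℓ
  WKValidOn φ = ∀ w → w ⊩ φ

WKValid : {Var : Set a} (ℓ : Level) → Formula Var → Set (a ⊔ lsuc ℓ)
WKValid {Var = Var} ℓ φ = (M : WKModel Var ℓ) → WKValidOn M φ

data AtomicProgram : Set where
  i m : AtomicProgram

infixr 9 _⨾_
infix  10 _⋆

data Program : Set where
  atomic : AtomicProgram → Program
  _⨾_    : Program → Program → Program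
  _⋆     : Program → Program

infixr 8 ~_ [_]_ ⟨_⟩_

data PDLFormula (Var : Set a) : Set a where
  var     : Var → PDLFormula Var
  ~_      : PDLFormula Var → PDLFormula Var
  _∧_ _∨_ : PDLFormula Var → PDLFormula Var → PDLFormula Var
  [_]_    : Program → PDLFormula Var → PDLFormula Var

⟨_⟩_ : {Var : Set a} → Program → PDLFormula Var → PDLFormula Var
⟨ α ⟩ φ = ~ [ α ] ~ φ

record PDLModel (Var : Set a) (ℓ : Level) : Set (a ⊔ lsuc ℓ) where
  field
    W : Set ℓ
    ρ : AtomicProgram → Rel W ℓ
    V : Var → Pred W ℓ

-- The clauses for ~_ and _∨_ are the classical Boolean ones only in a
-- classical metatheory, i.e. in the presence of ExcludedMiddle ℓ.
module _ {Var : Set a} (M : PDLModel Var ℓ) where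
  open PDLModel M

  ρ⟦_⟧ : Program → Rel W ℓ
  ρ⟦ atomic x ⟧ = ρ x
  ρ⟦ α ⨾ β ⟧    = ρ⟦ α ⟧ ; ρ⟦ β ⟧
  ρ⟦ α ⋆ ⟧      = Star ρ⟦ α ⟧

  infix 4 _⊨_

  _⊨_ : W → PDLFormula Var → Set ℓ
  w ⊨ var p     = w ∈ V p
  w ⊨ (~ φ)     = ¬ (w ⊨ φ)
  w ⊨ (φ ∧ ψ)   = w ⊨ φ × w ⊨ ψ
  w ⊨ (φ ∨ ψ)   = w ⊨ φ ⊎ w ⊨ ψ
  w ⊨ ([ α ] φ) = ∀ v → ρ⟦ α ⟧ w v → v ⊨ φ

  PDLValidOn : PDLFormula Var → Set ℓ
  PDLValidOn φ = ∀ w → w ⊨ φ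

PDLValid : {Var : Set a} (ℓ : Level) → PDLFormula Var → Set (a ⊔ lsuc ℓ)
PDLValid {Var = Var} ℓ φ = (M : PDLModel Var ℓ) → PDLValidOn M φ

module _ {Var : Set a} (p⊥ : Var) where

  private
    i⋆ : Program
    i⋆ = atomic i ⋆

  τ : Formula Var → PDLFormula Var
  τ bot     = var p⊥ ∧ ~ var p⊥
  τ (var p) = [ i⋆ ] var p
  τ (φ ∧ ψ) = τ φ ∧ τ ψ
  τ (φ ∨ ψ) = τ φ ∨ τ ψ
  τ (φ ⇒ ψ) = [ i⋆ ] ((~ τ φ) ∨ τ ψ)
  τ (□ φ)   = [ i⋆ ⨾ atomic m ] τ φ
  τ (◇ φ)   = [ i⋆ ] ⟨ atomic m ⟩ τ φ
  τ (□* φ)  = [ (i⋆ ⨾ atomic m) ⋆ ] τ φ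
  τ (◇* φ)  = [ i⋆ ] ⟨ atomic m ⋆ ⟩ τ φ

{-# OPTIONS --safe #-}
-- A WK-model and a PDL-model on the same worlds satisfy φ and τ φ at the same
-- points as soon as ≼ is the reflexive-transitive closure of ρ i, R is ρ m and
-- V p is the set of worlds satisfying [i⋆] p.  Every PDL-model has such a
-- partner, by taking these equations as definitions; every WK-model has one
-- with ρ i = ≼, because a preorder is its own closure and V p is upward closed.
module Submission where

open import Defs
open import Axiom.ExcludedMiddle using (ExcludedMiddle)
open import Data.Empty.Polymorphic using (⊥)
open import Data.Product using (_×_; _,_; ∃)
open import Data.Product.Function.NonDependent.Propositional using (_×-⇔_)
open import Data.Sum using (_⊎_; inj₁; inj₂; [_,_])
open import Data.Sum.Function.Propositional using (_⊎-⇔_)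
open import Function using (_∘_; id)
open import Function.Bundles using (_⇔_; mk⇔; module Equivalence)
open import Level using (Level)
open import Relation.Binary.Construct.Closure.ReflexiveTransitive
  using (Star; ε; _◅_; _◅◅_; fold; map)
open import Relation.Binary.Construct.Closure.ReflexiveTransitive.Properties
  using (isPreorder)
open import Relation.Binary.Construct.Composition using (_;_)
open import Relation.Binary.Core using (Rel)
open import Relation.Binary.PropositionalEquality using (_≡_)
open import Relation.Binary.Structures using (IsPreorder)
open import Relation.Nullary using (¬_; yes; no; contradiction)
open import Relation.Nullary.Decidable using (decidable-stable)
open import Relation.Unary using (Pred; Empty; _∈_)

open Equivalence using (to; from)

private
  variable
    a ℓ : Level

-- Only the forward direction is classical, as it decides `A`. The right side is how PDL, having no
-- implication, expresses one.
→⇔¬⊎ : ExcludedMiddle ℓ → {A B : Set ℓ} → (A → B) ⇔ (¬ A ⊎ B)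
→⇔¬⊎ em {A} {B} = mk⇔ forth [ (λ ¬x x → contradiction x ¬x) , (λ y _ → y) ]
  where
  forth : (A → B) → ¬ A ⊎ B
  forth f with em {A}
  ... | yes x = inj₂ (f x)
  ... | no ¬x = inj₁ ¬x

-- With `S` the successors of a world, the right side is an unfolded PDL diamond. Recovering the
-- witness is double negation elimination.
∃⇔¬∀¬ : ExcludedMiddle ℓ → {A : Set ℓ} {S P Q : Pred A ℓ} → (∀ x → P x ⇔ Q x) →
        (∃ λ x → S x × P x) ⇔ (¬ (∀ x → S x → ¬ Q x))
∃⇔¬∀¬ em P⇔Q = mk⇔
  (λ (x , sx , px) none → none x sx (to (P⇔Q x) px))
  (λ ¬none → decidable-stable em
    (λ ¬∃ → ¬none λ x sx qx → ¬∃ (x , sx , from (P⇔Q x) qx)))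

∀-cong-⇔ : {A : Set ℓ} {S T P Q : Pred A ℓ} →
           (∀ {x} → S x ⇔ T x) → (∀ x → P x ⇔ Q x) →
           (∀ x → S x → P x) ⇔ (∀ x → T x → Q x)
∀-cong-⇔ S⇔T P⇔Q = mk⇔
  (λ f x t → to (P⇔Q x) (f x (from S⇔T t)))
  (λ f x s → from (P⇔Q x) (f x (to S⇔T s)))

module _ (em : ExcludedMiddle ℓ) {Var : Set a} (p⊥ : Var) (N : PDLModel Var ℓ) where

  open PDLModel N using (W; ρ) renaming (V to U)

  module _
    {_≼_ : Rel W ℓ} (≼-preorder : IsPreorder _≡_ _≼_)
    {V : Var → Pred W ℓ} (V-mono : ∀ p {w v} → w ≼ v → w ∈ V p → v ∈ V p)
    {V⊥ : Pred W ℓ} (V⊥-empty : Empty V⊥)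
    (≼⇔i⋆ : ∀ {w v} → (w ≼ v) ⇔ Star (ρ i) w v)
    (V⇔[i⋆] : ∀ p {w} → (w ∈ V p) ⇔ (∀ v → Star (ρ i) w v → v ∈ U p))
    where

    private
      M : WKModel Var ℓ
      M = record
        { W = W ; _≼_ = _≼_ ; ≼-preorder = ≼-preorder ; R = ρ m
        ; V = V ; V⊥ = V⊥ ; V⊥-empty = V⊥-empty ; V-mono = V-mono }

    ≼⨾m⇔i⋆⨾m : ∀ {w v} → (_≼_ ; ρ m) w v ⇔ (Star (ρ i) ; ρ m) w v
    ≼⨾m⇔i⋆⨾m = mk⇔
      (λ (u , w≼u , s) → u , to ≼⇔i⋆ w≼u , s)
      (λ (u , w≼u , s) → u , from ≼⇔i⋆ w≼u , s)

    -- Induction on `φ` with the world left general, since the implication and modal clauses apply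
    -- the hypothesis at successors of `w`.
    ⊩⇔⊨τ : ∀ φ w → _⊩_ M w φ ⇔ _⊨_ N w (τ p⊥ φ)
    -- Both sides are contradictory, whatever the valuation of `p⊥`.
    ⊩⇔⊨τ bot w = mk⇔ (λ w∈V⊥ → contradiction w∈V⊥ (V⊥-empty w))
                      (λ (x , ¬x) → contradiction x ¬x)
    ⊩⇔⊨τ (var p) w = V⇔[i⋆] p
    ⊩⇔⊨τ (φ ∧ ψ) w = ⊩⇔⊨τ φ w ×-⇔ ⊩⇔⊨τ ψ w
    ⊩⇔⊨τ (φ ∨ ψ) w = ⊩⇔⊨τ φ w ⊎-⇔ ⊩⇔⊨τ ψ w
    ⊩⇔⊨τ (φ ⇒ ψ) w = ∀-cong-⇔ ≼⇔i⋆ λ v → mk⇔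
      (λ f → to (→⇔¬⊎ em) (to (⊩⇔⊨τ ψ v) ∘ f ∘ from (⊩⇔⊨τ φ v)))
      (λ d → from (⊩⇔⊨τ ψ v) ∘ from (→⇔¬⊎ em) d ∘ to (⊩⇔⊨τ φ v))
    ⊩⇔⊨τ (□ φ)  w = ∀-cong-⇔ ≼⨾m⇔i⋆⨾m (⊩⇔⊨τ φ)
    ⊩⇔⊨τ (◇ φ)  w = ∀-cong-⇔ ≼⇔i⋆ λ v → ∃⇔¬∀¬ em (⊩⇔⊨τ φ)
    -- Equivalent single steps have equivalent closures, by translating a path step by step.
    ⊩⇔⊨τ (□* φ) w = ∀-cong-⇔
      (mk⇔ (map (to ≼⨾m⇔i⋆⨾m)) (map (from ≼⨾m⇔i⋆⨾m))) (⊩⇔⊨τ φ)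
    ⊩⇔⊨τ (◇* φ) w = ∀-cong-⇔ ≼⇔i⋆ λ v → ∃⇔¬∀¬ em (⊩⇔⊨τ φ)

WKValid⇒PDLValid-τ : ExcludedMiddle ℓ → {Var : Set a} (p⊥ : Var) (φ : Formula Var) →
                     WKValid ℓ φ → PDLValid ℓ (τ p⊥ φ)
WKValid⇒PDLValid-τ em p⊥ φ valid N w = to (⊩⇔⊨τ em p⊥ N
    (isPreorder (ρ i)) V-mono {λ _ → ⊥} (λ _ ())
    -- The order and the valuation are defined as the right sides of these equivalences, so
    -- identities suffice.
    (mk⇔ id id) (λ _ → mk⇔ id id) φ w)
  (valid _ w)
  where
  open PDLModel N
  V-mono : ∀ p {w v} → Star (ρ i) w v →
           (∀ u → Star (ρ i) w u → u ∈ V p) → (∀ u → Star (ρ i) v u → u ∈ V p)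
  V-mono p w≼v f u v≼u = f u (w≼v ◅◅ v≼u)

PDLValid-τ⇒WKValid : ExcludedMiddle ℓ → {Var : Set a} (p⊥ : Var) (φ : Formula Var) →
                     PDLValid ℓ (τ p⊥ φ) → WKValid ℓ φ
PDLValid-τ⇒WKValid {ℓ = ℓ} em {Var} p⊥ φ valid M w = from (⊩⇔⊨τ em p⊥ N
    ≼-preorder V-mono V⊥-empty
    (mk⇔ (_◅ ε) Star⇒≼)
    -- Persistence carries `p` along a whole path; conversely, the empty path gives `p` at the
    -- starting world.
    (λ p → mk⇔ (λ x v s → V-mono p (Star⇒≼ s) x) (λ f → f _ ε)) φ w)
  (valid N w)
  where
  open WKModel M
  N : PDLModel Var ℓ
  N = record { W = W ; ρ = λ { i → _≼_ ; m → R } ; V = V }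
  Star⇒≼ : ∀ {w v} → Star _≼_ w v → w ≼ v
  Star⇒≼ = fold _≼_ (IsPreorder.trans ≼-preorder) (IsPreorder.refl ≼-preorder)

theorem5p5 : ∀ {a ℓ} → ExcludedMiddle ℓ → (Var : Set a) (p⊥ : Var) (φ : Formula Var) → WKValid ℓ φ ⇔ PDLValid ℓ (τ p⊥ φ)
theorem5p5 em Var p⊥ φ = mk⇔ (WKValid⇒PDLValid-τ em p⊥ φ) (PDLValid-τ⇒WKValid em p⊥ φ)
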